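{- For every integer $k\geq 2$ and every graph $G$ containing at most one cycle, $\nu_{k}(G) \geq \left \lfloor \frac{\nu_{k-1}(G) + \nu_{k+1}(G)}{2} \right \rfloor$.
   Context: Graphs are finite, without loops, possibly with multiple edges. For $k\geq 1$, $\nu_k(G)$ is the maximum number of edges of a $k$-edge-colorable subgraph of $G$. -}

module Defs where

open import Data.Nat.Base using (ℕ; zero; suc; _≤_; s≤s; NonZero)
import Data.Nat.Properties as ℕ
open import Data.Fin.Base using (Fin; zero; suc; inject₁; fromℕ; finToFun; funToFin)
open import Data.Fin.Properties using (_≟_; any?; all?; finToFun-funToFin)
open import Data.Fin.Subset using (Subset; _∈_; ∣_∣; ⊥)
open import Data.Fin.Subset.Properties using (_∈?_; anySubset?; ∣p∣≤n; ∣⊥∣≡0; ∉⊥)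
open import Data.List.Base using (filter; upTo)
open import Data.List.Extrema.Nat using (max; xs≤max; argmax-sel)
import Data.List.Relation.Unary.All as All
open import Data.List.Membership.Propositional.Properties
  using (∈-filter⁺; ∈-filter⁻; ∈-upTo⁺)
open import Data.Product.Base using (∃-syntax; _×_; _,_; proj₂)
open import Data.Sum.Base using (_⊎_; inj₁; inj₂)
open import Function.Base using (id)
open import Function.Bundles using (_⇔_)
open import Function.Definitions using (Injective)
open import Relation.Binary.PropositionalEquality
  using (_≡_; _≢_; refl; sym; trans; subst)
open import Relation.Nullary using (Dec; contradiction)
open import Relation.Nullary.Decidable using (map′; _×-dec_; _⊎-dec_; _→-dec_; ¬?)

-- Edges are undirected: the order of the two ends is irrelevant to every
-- notion below.  Distinct edges may have the same ends.
record Graph : Set where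
  field
    ∣V∣ ∣E∣   : ℕ
    end₁ end₂ : Fin ∣E∣ → Fin ∣V∣
    loopless  : ∀ e → end₁ e ≢ end₂ e

  Vertex Edge : Set
  Vertex = Fin ∣V∣
  Edge   = Fin ∣E∣

  Incident : Vertex → Edge → Set
  Incident v e = end₁ e ≡ v ⊎ end₂ e ≡ v

  Joins : Edge → Vertex → Vertex → Set
  Joins e u v = (end₁ e ≡ u × end₂ e ≡ v) ⊎ (end₁ e ≡ v × end₂ e ≡ u)

  Adjacent : Edge → Edge → Set
  Adjacent e f = e ≢ f × ∃[ v ] (Incident v e × Incident v f)

  -- v₀ e₀ v₁ e₁ … vₗ eₗ v₀ with l ≥ 1, so two parallel edges form a cycle.
  -- Injectivity of the edges matters only for l = 1, where it prevents a
  -- single edge from being traversed back and forth.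
  record Cycle : Set where
    field
      {l}              : ℕ
      1≤l              : 1 ≤ l
      vertex           : Fin (suc l) → Vertex
      edge             : Fin (suc l) → Edge
      vertex-injective : Injective _≡_ _≡_ vertex
      edge-injective   : Injective _≡_ _≡_ edge
      step             : (i : Fin l) →
                         Joins (edge (inject₁ i)) (vertex (inject₁ i)) (vertex (suc i))
      close            : Joins (edge (fromℕ l)) (vertex (fromℕ l)) (vertex zero)

  _∈ᶜ_ : Edge → Cycle → Set
  e ∈ᶜ C = ∃[ i ] Cycle.edge C i ≡ e

  -- Cycles are counted as subgraphs, regardless of starting vertex and
  -- direction; such a subgraph is determined by its edges.
  AtMostOneCycle : Set
  AtMostOneCycle = (C D : Cycle) → ∀ e → (e ∈ᶜ C) ⇔ (e ∈ᶜ D)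

  -- A subgraph is given by its set of edges, since its isolated vertices affect
  -- neither its colourings nor its number of edges.  Colours of edges outside S
  -- are unconstrained: for k ≥ 1 a colouring of S is the restriction of a total
  -- function.
  Proper : ∀ {k} → Subset ∣E∣ → (Edge → Fin k) → Set
  Proper S c = ∀ e f → e ∈ S → f ∈ S → Adjacent e f → c e ≢ c f

  Colourable : ℕ → Subset ∣E∣ → Set
  Colourable k S = ∃[ c ] Proper {k} S c

  HasColourableSubgraph : ℕ → ℕ → Set
  HasColourableSubgraph k j = ∃[ S ] (Colourable k S × ∣ S ∣ ≡ j)

  adjacent? : ∀ e f → Dec (Adjacent e f)
  adjacent? e f = ¬? (e ≟ f) ×-dec any? λ v → incident? v e ×-dec incident? v f
    where
    incident? : ∀ v e → Dec (Incident v e)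
    incident? v e = (end₁ e ≟ v) ⊎-dec (end₂ e ≟ v)

  proper? : ∀ {k} S (c : Edge → Fin k) → Dec (Proper S c)
  proper? S c = all? λ e → all? λ f →
    (e ∈? S) →-dec ((f ∈? S) →-dec (adjacent? e f →-dec ¬? (c e ≟ c f)))

  colourable? : ∀ k S → Dec (Colourable k S)
  colourable? k S =
    map′ (λ (i , p) → finToFun i , p) encode (any? λ i → proper? S (finToFun {k} {∣E∣} i))
    where
    encode : Colourable k S → ∃[ i ] Proper S (finToFun {k} {∣E∣} i)
    encode (c , p) = funToFin c , λ e f e∈S f∈S adj eq → p e f e∈S f∈S adj
      (trans (sym (finToFun-funToFin c e)) (trans eq (finToFun-funToFin c f)))

  hasColourableSubgraph? : ∀ k j → Dec (HasColourableSubgraph k j)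
  hasColourableSubgraph? k j =
    anySubset? λ S → colourable? k S ×-dec (∣ S ∣ ℕ.≟ j)

open Graph public using (AtMostOneCycle)

ν : ℕ → Graph → ℕ
ν k G = max 0 (filter (hasColourableSubgraph? k) (upTo (suc ∣E∣)))
  where open Graph G

module _ (k : ℕ) (G : Graph) where
  open Graph G

  ν-upper : ∀ S → Colourable k S → ∣ S ∣ ≤ ν k G
  ν-upper S col = All.lookup (xs≤max 0 _)
    (∈-filter⁺ (hasColourableSubgraph? k) (∈-upTo⁺ (s≤s (∣p∣≤n S))) (S , col , refl))

  ν-attained : .{{NonZero k}} → HasColourableSubgraph k (ν k G)
  ν-attained with argmax-sel id 0 (filter (hasColourableSubgraph? k) (upTo (suc ∣E∣)))
  ... | inj₂ ν∈ = proj₂ (∈-filter⁻ (hasColourableSubgraph? k) {xs = upTo (suc ∣E∣)} ν∈)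
  ... | inj₁ ν≡0 = subst (HasColourableSubgraph k) (sym ν≡0) (empty k)
    where
    empty : ∀ k → .{{NonZero k}} → HasColourableSubgraph k 0
    empty (suc k) =
      ⊥ , ((λ _ → zero) , λ _ _ e∈⊥ → contradiction e∈⊥ ∉⊥) , ∣⊥∣≡0 ∣E∣

{-# OPTIONS --safe #-}
module Submission where

-- Let S be (k−1)-colourable and T (k+1)-colourable.  Suppose every edge of S Δ T
-- is a bridge of S ∪ T.  Then S and T together can be redistributed into two
-- k-colourable sets: use two copies of the k colours as 2k slots, start with a
-- colouring of S ∩ T in which an edge takes both copies of its colour, and add the
-- edges of S Δ T one by one, each taking one slot.  At either end of the new edge
-- a slot is free, because the colourings of S and T show that at most
-- (k−1) + (k+1) = 2k slots, one of them for the new edge itself, are needed there;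
-- since that edge is a bridge, renaming
-- the slots on one side of it makes the same slot free at both ends.
-- If some edge of S Δ T is not a bridge, it lies on the unique cycle, and deleting
-- it turns all other edges into bridges at the cost of one edge, which the floor
-- absorbs.

open import Defs
open import Data.Nat using (ℕ; _+_; _∸_; _≤_; _≥_)
open import Data.Nat.DivMod using (_/_)
open import Data.Bool.Base using (Bool; true; false; _∨_; if_then_else_)
open import Data.Bool.Properties using (∨-zeroʳ)
open import Data.Empty using (⊥)
open import Data.Fin.Base
  using (Fin; zero; suc; inject₁; inject≤; fromℕ; join; splitAt; remQuot; combine; _<_)
open import Data.Fin.Permutation.Components using (transpose; transpose-inverse)
open import Data.Fin.Properties
  using (_≟_; any?; suc-injective; inject≤-injective; pigeonhole; splitAt-join; combine-remQuot; <⇒≢)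
open import Data.Fin.Subset using (Subset; inside; outside; _∈_; _∉_; _⊆_; _∪_; _∩_; _-_; ∣_∣)
open import Data.Fin.Subset.Properties using (_∈?_; x∈p∪q⁻; x∈p∩q⁻; p─q⊆p; p─⊥≡p)
open import Data.List.Base using (List; []; _∷_; allFin; filter)
import Data.List.Membership.DecPropositional as DecMembership
open import Data.List.Membership.Propositional using () renaming (_∈_ to _∈ˡ_)
open import Data.List.Membership.Propositional.Properties using (∈-allFin; ∈-filter⁺)
open import Data.List.Relation.Unary.All using (All; []; _∷_)
open import Data.List.Relation.Unary.All.Properties using (all-filter)
open import Data.List.Relation.Unary.Any using (here; there)
open import Data.Nat.Base using (zero; suc; _*_; z≤n; s≤s; s≤s⁻¹)
open import Data.Nat.DivMod using (m<n*o⇒m/o<n)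
open import Data.Nat.Properties
  using (+-suc; +-identityʳ; *-comm; ≤-refl; ≤-trans; ≤-reflexive; n≤1+n; m≤n⇒m≤1+n;
         +-mono-≤; +-monoˡ-≤; +-monoʳ-≤; module ≤-Reasoning)
open import Data.Nat.Tactic.RingSolver using (solve-∀)
open import Data.Product.Base
  using (Σ-syntax; ∃-syntax; _×_; _,_; proj₁; proj₂; map; uncurry)
open import Data.Sum.Base using (_⊎_; inj₁; inj₂; [_,_]′; map₁; map₂)
open import Data.Sum.Properties using (inj₁-injective; inj₂-injective)
open import Data.Vec.Base using ([]; _∷_; here; there; tabulate; lookup)
open import Data.Vec.Properties using ([]=⇒lookup; lookup⇒[]=; lookup∘tabulate)
open import Function.Base using (_∘_)
open import Function.Bundles using (Equivalence)
open import Level using (0ℓ)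
open import Relation.Binary.PropositionalEquality
  using (_≡_; _≢_; refl; sym; trans; cong; cong₂; subst; subst₂)
open import Relation.Nullary using (¬_; Dec; yes; no; contradiction)
open import Relation.Nullary.Decidable
  using (_×-dec_; _⊎-dec_; ¬?; does; dec-true; decidable-stable)
open import Relation.Unary using (Pred; Decidable)

-- Deleting an element, halving, finite search

x∉p-x : ∀ {n} {x : Fin n} (p : Subset n) → x ∉ p - x
x∉p-x {x = zero}  (_ ∷ _) ()
x∉p-x {x = suc _} (_ ∷ p) (there x∈) = x∉p-x p x∈

∣p∣≤1+∣p-x∣ : ∀ {n} (p : Subset n) x → ∣ p ∣ ≤ suc ∣ p - x ∣
∣p∣≤1+∣p-x∣ (outside ∷ p) zero    = m≤n⇒m≤1+n (≤-reflexive (cong ∣_∣ (sym (p─⊥≡p p))))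
∣p∣≤1+∣p-x∣ (inside  ∷ p) zero    = s≤s (≤-reflexive (cong ∣_∣ (sym (p─⊥≡p p))))
∣p∣≤1+∣p-x∣ (outside ∷ p) (suc x) = ∣p∣≤1+∣p-x∣ p x
∣p∣≤1+∣p-x∣ (inside  ∷ p) (suc x) = s≤s (∣p∣≤1+∣p-x∣ p x)

-- Halving rounds down, which absorbs the unit that pays for a deleted edge.
m≤1+n+n⇒m/2≤n : ∀ {m n} → m ≤ suc (n + n) → m / 2 ≤ n
m≤1+n+n⇒m/2≤n {m} {n} m≤ = s≤s⁻¹ (m<n*o⇒m/o<n (begin-strict
  m             ≤⟨ m≤ ⟩
  suc (n + n)   <⟨ ≤-refl ⟩
  2 + (n + n)   ≡⟨ cong (λ z → 2 + (n + z)) (+-identityʳ n) ⟨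
  2 + 2 * n     ≡⟨ cong (2 +_) (*-comm 2 n) ⟩
  suc n * 2     ∎))
  where open ≤-Reasoning

all-or-any : ∀ {n} {P Q : Pred (Fin n) 0ℓ} → (∀ i → P i ⊎ Q i) → (∀ i → P i) ⊎ ∃[ i ] Q i
all-or-any {zero}          f = inj₁ λ ()
all-or-any {suc _} {P} {Q} f with f zero | all-or-any {P = P ∘ suc} {Q ∘ suc} (f ∘ suc)
... | inj₁ p | inj₁ ps      = inj₁ λ { zero → p ; (suc i) → ps i }
... | inj₁ _ | inj₂ (i , q) = inj₂ (suc i , q)
... | inj₂ q | _            = inj₂ (zero , q)

-- Walks, cycles and bridges

module _ (G : Graph) where
  open Graph G hiding (AtMostOneCycle)

  data Walk (P : Pred Edge 0ℓ) : Vertex → Vertex → Set where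
    []   : ∀ {v} → Walk P v v
    step : ∀ {e u v w} → P e → Joins e u v → Walk P v w → Walk P u w

  module _ {P : Pred Edge 0ℓ} where

    _++_ : ∀ {u v w} → Walk P u v → Walk P v w → Walk P u w
    []         ++ w′ = w′
    step p j w ++ w′ = step p j (w ++ w′)

    length : ∀ {u v} → Walk P u v → ℕ
    length []           = 0
    length (step _ _ w) = suc (length w)

    vertexAt : ∀ {u v} (w : Walk P u v) → Fin (suc (length w)) → Vertex
    vertexAt {u}          _ zero    = u
    vertexAt (step _ _ w)   (suc i) = vertexAt w i

    Simple : ∀ {u v} → Walk P u v → Set
    Simple w = ∀ i j → vertexAt w i ≡ vertexAt w j → i ≡ j

    tail-simple : ∀ {e u v w} (p : P e) (j : Joins e u v) (W : Walk P v w) →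
                  Simple (step p j W) → Simple W
    tail-simple _ _ _ s i i′ eq = suc-injective (s (suc i) (suc i′) eq)

    suffix : ∀ {u v} (w : Walk P u v) → Simple w → ∀ i →
             ∃[ w′ ] Simple {vertexAt w i} {v} w′
    suffix w            s zero    = w , s
    suffix (step p j w) s (suc i) = suffix w (tail-simple p j w s) i

    -- Loop erasure: if the start recurs on the simplified remainder, the walk is cut down to the
    -- suffix beginning there.
    simplify : ∀ {u v} → Walk P u v → ∃[ w ] Simple {u} {v} w
    simplify [] = [] , λ { zero zero _ → refl }
    simplify {u} (step p j w) with simplify w
    ... | w′ , s with any? (λ i → vertexAt w′ i ≟ u)
    ... | yes (i , refl) = suffix w′ s i
    ... | no  u∉w′       = step p j w′ , λ
      { zero    zero     _  → refl
      ; zero    (suc i)  eq → contradiction (i , sym eq) u∉w′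
      ; (suc i) zero     eq → contradiction (i , eq) u∉w′
      ; (suc i) (suc i′) eq → cong suc (s i i′ eq) }

    vertexAt-last : ∀ {u v} (w : Walk P u v) → vertexAt w (fromℕ (length w)) ≡ v
    vertexAt-last []           = refl
    vertexAt-last (step _ _ w) = vertexAt-last w

    module _ (g : Edge) where

      -- The edges of the walk, followed by g, which is to close it into a cycle.
      edgeAt : ∀ {u v} (w : Walk P u v) → Fin (suc (length w)) → Edge
      edgeAt []                   _       = g
      edgeAt (step {e = e} _ _ _) zero    = e
      edgeAt (step _ _ w)         (suc i) = edgeAt w i

      edgeAt-last : ∀ {u v} (w : Walk P u v) → edgeAt w (fromℕ (length w)) ≡ g
      edgeAt-last []           = refl
      edgeAt-last (step _ _ w) = edgeAt-last w

      edgeAt-joins : ∀ {u v} (w : Walk P u v) (i : Fin (length w)) →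
        Joins (edgeAt w (inject₁ i)) (vertexAt w (inject₁ i)) (vertexAt w (suc i))
      edgeAt-joins (step _ j _) zero    = j
      edgeAt-joins (step _ _ w) (suc i) = edgeAt-joins w i

      Along : ∀ {u v} → Walk P u v → Edge → Set
      Along w e = P e × (∀ x → Incident x e → ∃[ i ] vertexAt w i ≡ x)

      edgeAt-along : ∀ {u v} (w : Walk P u v) i → Along w (edgeAt w i) ⊎ edgeAt w i ≡ g
      edgeAt-along []           _    = inj₂ refl
      edgeAt-along (step p (inj₁ (refl , refl)) w) zero = inj₁ (p , λ
        { _ (inj₁ refl) → zero , refl
        ; _ (inj₂ refl) → suc zero , refl })
      edgeAt-along (step p (inj₂ (refl , refl)) w) zero = inj₁ (p , λ
        { _ (inj₁ refl) → suc zero , refl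
        ; _ (inj₂ refl) → zero , refl })
      edgeAt-along (step _ _ w) (suc i) with edgeAt-along w i
      ... | inj₁ (q , on) = inj₁ (q , λ x inc → let i′ , eq = on x inc in suc i′ , eq)
      ... | inj₂ eq       = inj₂ eq

      module _ (¬Pg : ¬ P g) where

        -- If `e` recurred in `W`, its end `u` would be a vertex of `W`, against simplicity. It is
        -- not the closing edge either, as `P` holds for `e` and fails for `g`.
        first-edge-fresh : ∀ {e u v w} (p : P e) (j : Joins e u v) (W : Walk P v w) →
                           Simple (step p j W) → ∀ i → e ≢ edgeAt W i
        first-edge-fresh {e} p j W s i e≡ with edgeAt-along W i
        ... | inj₂ ≡g       = ¬Pg (subst P (trans e≡ ≡g) p)
        ... | inj₁ (_ , on) with on _ (subst (Incident _) e≡ (start j))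
          where
          start : ∀ {u v} → Joins e u v → Incident u e
          start (inj₁ (e₁≡u , _)) = inj₁ e₁≡u
          start (inj₂ (_ , e₂≡u)) = inj₂ e₂≡u
        ...   | i′ , eq with () ← s (suc i′) zero eq

        edgeAt-injective : ∀ {u v} (w : Walk P u v) → Simple w →
                           ∀ i i′ → edgeAt w i ≡ edgeAt w i′ → i ≡ i′
        edgeAt-injective []           _ zero    zero     _  = refl
        edgeAt-injective (step _ _ _) _ zero    zero     _  = refl
        edgeAt-injective (step p j w) s zero    (suc i)  eq =
          contradiction eq (first-edge-fresh p j w s i)
        edgeAt-injective (step p j w) s (suc i) zero     eq =
          contradiction (sym eq) (first-edge-fresh p j w s i)
        edgeAt-injective (step p j w) s (suc i) (suc i′) eq =
          cong suc (edgeAt-injective w (tail-simple p j w s) i i′ eq)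

        closeWalk : Walk P (end₂ g) (end₁ g) →
                    ∃[ C ] (g ∈ᶜ C × (∀ f → f ∈ᶜ C → P f ⊎ f ≡ g))
        closeWalk walk with simplify walk
        ... | w , s = C , (fromℕ _ , edgeAt-last w) , member
          where
          nonempty : ∀ {u v} (w : Walk P u v) → u ≢ v → 1 ≤ length w
          nonempty []           u≢v = contradiction refl u≢v
          nonempty (step _ _ _) _   = s≤s z≤n

          C : Cycle
          C = record
            { 1≤l              = nonempty w (λ eq → loopless g (sym eq))
            ; vertex           = vertexAt w
            ; edge             = edgeAt w
            ; vertex-injective = s _ _
            ; edge-injective   = edgeAt-injective w s _ _
            ; step             = edgeAt-joins w
            -- The last index carries `g`, which leads from the last vertex `end₁ g` back to the
            -- first, `end₂ g`.
            ; close            = inj₁ ( trans (cong end₁ (edgeAt-last w)) (sym (vertexAt-last w))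
                                      , cong end₂ (edgeAt-last w) )
            }

          member : ∀ f → f ∈ᶜ C → P f ⊎ f ≡ g
          member _ (i , refl) with edgeAt-along w i
          ... | inj₁ (Pf , _) = inj₁ Pf
          ... | inj₂ eq       = inj₂ eq

    Closed : (Vertex → Bool) → Edge → Set
    Closed A e = A (end₁ e) ≡ A (end₂ e)

    -- When `es` lists exactly the edges satisfying `P`, such an `A` is the component of `u`:
    -- closure bounds it from below, the walks from above.
    Reachable : List Edge → Vertex → (Vertex → Bool) → Set
    Reachable es u A =
      A u ≡ true × (∀ {e} → e ∈ˡ es → Closed A e) × (∀ x → A x ≡ true → Walk P u x)

    reach-across : ∀ {es e A B u v w} → P e → Joins e v w → A v ≡ true →
                   Reachable es u A → Reachable es w B →
                   Reachable (e ∷ es) u (λ x → A x ∨ B x)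
    reach-across {e = e} {A} {B} {u} {v} {w} p j Av (Au , closedA , walkA) (Bw , closedB , walkB) =
      cong (_∨ B u) Au , closed , walk
      where
      Cv : A v ∨ B v ≡ true
      Cv = cong (_∨ B v) Av

      Cw : A w ∨ B w ≡ true
      Cw = trans (cong (A w ∨_) Bw) (∨-zeroʳ (A w))

      across : Joins e v w → Closed (λ x → A x ∨ B x) e
      across (inj₁ (refl , refl)) = trans Cv (sym Cw)
      across (inj₂ (refl , refl)) = trans Cw (sym Cv)

      closed : ∀ {f} → f ∈ˡ e ∷ _ → Closed (λ x → A x ∨ B x) f
      closed (here refl) = across j
      closed (there f∈)  = cong₂ _∨_ (closedA f∈) (closedB f∈)

      walk : ∀ x → A x ∨ B x ≡ true → Walk P u x
      walk x eq with A x in Ax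
      ... | true  = walkA x Ax
      ... | false = walkA v Av ++ step p j (walkB x eq)

    -- If the head edge leaves the set reached by the tail, the set reached from its outer end is
    -- merged in. Both sets are closed under the tail and the union contains both ends of the head,
    -- so one merge suffices.
    reach : ∀ es → All P es → ∀ u → ∃[ A ] Reachable es u A
    reach []       []       u = (λ x → does (x ≟ u)) , dec-true (u ≟ u) refl , (λ ()) , walk
      where
      walk : ∀ x → does (x ≟ u) ≡ true → Walk P u x
      walk x eq with x ≟ u
      ... | yes refl = []
    reach (e ∷ es) (p ∷ ps) u with reach es ps u
    ... | A , r@(Au , closedA , walkA) with A (end₁ e) in A₁ | A (end₂ e) in A₂
    ...   | true  | false = _ , reach-across p (inj₁ (refl , refl)) A₁ r (proj₂ (reach es ps (end₂ e)))
    ...   | false | true  = _ , reach-across p (inj₂ (refl , refl)) A₂ r (proj₂ (reach es ps (end₁ e)))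
    ...   | true  | true  = A , Au , (λ { (here refl) → trans A₁ (sym A₂) ; (there f∈) → closedA f∈ }) , walkA
    ...   | false | false = A , Au , (λ { (here refl) → trans A₁ (sym A₂) ; (there f∈) → closedA f∈ }) , walkA

  -- The cut is kept as data because one side of it is where slots get renamed.
  Bridge : Pred Edge 0ℓ → Edge → Set
  Bridge H g = Σ[ A ∈ (Vertex → Bool) ]
    (A (end₁ g) ≡ false × A (end₂ g) ≡ true × (∀ f → H f → f ≢ g → A (end₁ f) ≡ A (end₂ f)))

  -- A set is grown from `end₂ g` along the other edges of `H`. Either it misses `end₁ g` and is the
  -- cut, or a walk between the two ends closes up with `g`.
  bridge-or-cycle : ∀ {H : Pred Edge 0ℓ} → Decidable H → ∀ g →
    Bridge H g ⊎ ∃[ C ] (g ∈ᶜ C × (∀ f → f ∈ᶜ C → H f ⊎ f ≡ g))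
  bridge-or-cycle {H} H? g =
    search (reach (filter P? (allFin ∣E∣)) (all-filter P? (allFin ∣E∣)) (end₂ g))
    where
    P? : Decidable (λ f → H f × f ≢ g)
    P? f = H? f ×-dec ¬? (f ≟ g)

    search : ∃[ A ] Reachable (filter P? (allFin ∣E∣)) (end₂ g) A →
             Bridge H g ⊎ ∃[ C ] (g ∈ᶜ C × (∀ f → f ∈ᶜ C → H f ⊎ f ≡ g))
    search (A , A₂ , closed , walk) with A (end₁ g) in A₁
    ... | false = inj₁ (A , A₁ , A₂ , λ f Hf f≢g → closed (∈-filter⁺ P? (∈-allFin f) (Hf , f≢g)))
    ... | true with closeWalk g (λ (_ , g≢g) → g≢g refl) (walk (end₁ g) A₁)
    ...   | C , g∈C , member = inj₂ (C , g∈C , λ f f∈C → map₁ proj₁ (member f f∈C))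

-- Redistributing two edge sets into two parts

Either Both : ∀ {n} → Subset n → Subset n → Pred (Fin n) 0ℓ
Either S T e = e ∈ S ⊎ e ∈ T
Both   S T e = e ∈ S × e ∈ T

either? : ∀ {n} (S T : Subset n) → Decidable (Either S T)
either? S T e = (e ∈? S) ⊎-dec (e ∈? T)

both? : ∀ {n} (S T : Subset n) → Decidable (Both S T)
both? S T e = (e ∈? S) ×-dec (e ∈? T)

transpose-left : ∀ {n} (i j : Fin n) → transpose i j i ≡ j
transpose-left i j rewrite dec-true (i ≟ i) refl = refl

-- The edges in exactly one of S and T go to the part named by c, those in both go to
-- each part.
part : ∀ {n} → (Fin n → Fin 2) → Fin 2 → Subset n → Subset n → Subset n
part c b S T = tabulate λ e → if does (c e ≟ b) then lookup (S ∪ T) e else lookup (S ∩ T) e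

∣part∣ : ∀ {n} (c : Fin n → Fin 2) (S T : Subset n) →
         ∣ part c zero S T ∣ + ∣ part c (suc zero) S T ∣ ≡ ∣ S ∣ + ∣ T ∣
∣part∣ c []      []      = refl
∣part∣ c (x ∷ S) (y ∷ T) = head x y (c zero)
  where
  P₀ = part (c ∘ suc) zero S T
  P₁ = part (c ∘ suc) (suc zero) S T
  ih = ∣part∣ (c ∘ suc) S T

  +-suc₂ : ∀ {a b a′ b′} → a + b ≡ a′ + b′ → a + suc b ≡ a′ + suc b′
  +-suc₂ {a} {b} {a′} {b′} eq = trans (+-suc a b) (trans (cong suc eq) (sym (+-suc a′ b′)))

  head : ∀ x y c₀ →
    ∣ (if does (c₀ ≟ zero) then x ∨ y else lookup ((x ∷ S) ∩ (y ∷ T)) zero) ∷ P₀ ∣ +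
    ∣ (if does (c₀ ≟ suc zero) then x ∨ y else lookup ((x ∷ S) ∩ (y ∷ T)) zero) ∷ P₁ ∣
    ≡ ∣ x ∷ S ∣ + ∣ y ∷ T ∣
  head outside outside zero       = ih
  head outside outside (suc zero) = ih
  head outside inside  zero       = trans (cong suc ih) (sym (+-suc _ _))
  head outside inside  (suc zero) = +-suc₂ ih
  head inside  outside zero       = cong suc ih
  head inside  outside (suc zero) = trans (+-suc _ _) (cong suc ih)
  head inside  inside  zero       = cong suc (+-suc₂ ih)
  head inside  inside  (suc zero) = cong suc (+-suc₂ ih)

∈-part⁻ : ∀ {n} {c : Fin n → Fin 2} {b} (S T : Subset n) {e} → e ∈ part c b S T →
          Both S T e ⊎ Either S T e × c e ≡ b
∈-part⁻ {c = c} {b} S T {e} e∈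
  with c e ≟ b | trans (sym (lookup∘tabulate _ e)) ([]=⇒lookup e∈)
... | yes eq | ∈∪ = inj₂ (x∈p∪q⁻ S T (lookup⇒[]= e (S ∪ T) ∈∪) , eq)
... | no  _  | ∈∩ = inj₁ (x∈p∩q⁻ S T (lookup⇒[]= e (S ∩ T) ∈∩))

-- Slot assignments and their extension across a bridge

module _ (G : Graph) where
  open Graph G hiding (AtMostOneCycle)
  open DecMembership (_≟_ {∣E∣}) using () renaming (_∈?_ to _∈ˡ?_)

  incident? : ∀ v e → Dec (Incident v e)
  incident? v e = (end₁ e ≟ v) ⊎-dec (end₂ e ≟ v)

  proper-injective : ∀ {k S} {c : Edge → Fin k} → Proper S c → ∀ {e f v} →
    e ∈ S → f ∈ S → Incident v e → Incident v f → c e ≡ c f → e ≡ f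
  proper-injective proper {e} {f} e∈S f∈S ve vf eq with e ≟ f
  ... | yes e≡f = e≡f
  ... | no  e≢f = contradiction eq (proper e f e∈S f∈S (e≢f , _ , ve , vf))

  module _ {k p q : ℕ} (p≤k : p ≤ k) (p+q≤2k : p + q ≤ 2 * k)
           {S T : Subset ∣E∣}
           {cS : Edge → Fin p} (properS : Proper S cS)
           {cT : Edge → Fin q} (properT : Proper T cT)
           where

    -- The edges assigned so far: those of S ∩ T from the start, those of S Δ T once they are
    -- listed.
    Active : List Edge → Pred Edge 0ℓ
    Active es e = Both S T e ⊎ (Either S T e × e ∈ˡ es)

    active? : ∀ es → Decidable (Active es)
    active? es e = both? S T e ⊎-dec (either? S T e ×-dec (e ∈ˡ? es))

    active⇒either : ∀ {es e} → Active es e → Either S T e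
    active⇒either (inj₁ (e∈S , _)) = inj₁ e∈S
    active⇒either (inj₂ (h , _))   = h

    drop : ∀ {es f g} → (Either S T g → Active es g) → Active (g ∷ es) f → Active es f
    drop _  (inj₁ b)                = inj₁ b
    drop ag (inj₂ (hf , here refl)) = ag hf
    drop _  (inj₂ (hf , there f∈))  = inj₂ (hf , f∈)

    -- Labels the slots taken at a vertex by colours of S and T: when e lies in both,
    -- its two slots get its two colours.
    data Token (b : Fin 2) (e : Edge) : Fin p ⊎ Fin q → Set where
      inS : e ∈ S → (e ∈ T → b ≡ zero) → Token b e (inj₁ (cS e))
      inT : e ∈ T → (e ∈ S → b ≡ suc zero) → Token b e (inj₂ (cT e))

    token : ∀ b {e} → Either S T e → ∃[ x ] Token b e x
    token b {e} h with e ∈? S | e ∈? T | b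
    ... | yes e∈S | yes e∈T | zero     = _ , inS e∈S (λ _ → refl)
    ... | yes e∈S | yes e∈T | suc zero = _ , inT e∈T (λ _ → refl)
    ... | yes e∈S | no e∉T  | _        = _ , inS e∈S (λ e∈T → contradiction e∈T e∉T)
    ... | no e∉S  | yes e∈T | _        = _ , inT e∈T (λ e∈S → contradiction e∈S e∉S)
    token b (inj₁ e∈S) | no e∉S | no e∉T | _ = contradiction e∈S e∉S
    token b (inj₂ e∈T) | no e∉S | no e∉T | _ = contradiction e∈T e∉T

    -- Equal tokens carry the same colour of the same set, so properness at `v` identifies the
    -- edges. For an edge in both sets, the choice of set reveals the copy.
    token-injective : ∀ {b c e f x y v} → Incident v e → Incident v f →
      Token b e x → Token c f y → x ≡ y → e ≡ f × (Both S T e → b ≡ c)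
    token-injective ve vf (inS e∈S b₀) (inS f∈S c₀) eq
      with refl ← proper-injective properS e∈S f∈S ve vf (inj₁-injective eq) =
      refl , λ (_ , e∈T) → trans (b₀ e∈T) (sym (c₀ e∈T))
    token-injective ve vf (inT e∈T b₁) (inT f∈T c₁) eq
      with refl ← proper-injective properT e∈T f∈T ve vf (inj₂-injective eq) =
      refl , λ (e∈S , _) → trans (b₁ e∈S) (sym (c₁ e∈S))

    Slot : Set
    Slot = Fin 2 × Fin k

    -- The second argument is the slot assigned to the edge; for an edge in both S and T
    -- only the colour of that slot matters.
    Occupies : Edge → Slot → Slot → Set
    Occupies e (b , i) (c , j) = i ≡ j × (Both S T e ⊎ b ≡ c)

    occupies? : ∀ e y x → Dec (Occupies e y x)
    occupies? e (b , i) (c , j) = (i ≟ j) ×-dec (both? S T e ⊎-dec (b ≟ c))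

    OccupiedAt : List Edge → (Edge → Slot) → Vertex → Slot → Set
    OccupiedAt es d v x = ∃[ f ] (Active es f × Incident v f × Occupies f (d f) x)

    occupiedAt? : ∀ es d v x → Dec (OccupiedAt es d v x)
    occupiedAt? es d v x =
      any? λ f → active? es f ×-dec (incident? v f ×-dec occupies? f (d f) x)

    -- Were all 2k slots occupied at `v`, their edges together with `g` would give 2k + 1 tokens
    -- among p + q ≤ 2k colours. A collision would make two slots equal or make `g` active.
    free-slot : ∀ es d {g v} → Either S T g → ¬ Active es g → Incident v g →
                ∃[ x ] ¬ OccupiedAt es d v x
    free-slot es d {g} {v} hg ¬ag vg
      with any? (λ b → any? λ i → ¬? (occupiedAt? es d v (b , i)))
    ... | yes (b , i , free) = (b , i) , free
    ... | no  none           = contradiction (pigeonhole (s≤s p+q≤2k) φ) no-collision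
      where
      slot : Fin (2 * k) → Slot
      slot = remQuot k

      occupied : ∀ i → OccupiedAt es d v (slot i)
      occupied i = decidable-stable (occupiedAt? es d v (slot i)) λ free → none (_ , _ , free)

      edge : Fin (suc (2 * k)) → Edge
      edge zero    = g
      edge (suc i) = proj₁ (occupied i)

      side : Fin (suc (2 * k)) → Fin 2
      -- A default: `g` lies in only one of S and T, so its token is the same for either copy.
      side zero    = zero
      side (suc i) = proj₁ (slot i)

      either : ∀ i → Either S T (edge i)
      either zero    = hg
      either (suc i) = active⇒either (proj₁ (proj₂ (occupied i)))

      at-v : ∀ i → Incident v (edge i)
      at-v zero    = vg
      at-v (suc i) = proj₁ (proj₂ (proj₂ (occupied i)))

      tok : ∀ i → ∃[ x ] Token (side i) (edge i) x
      tok i = token (side i) (either i)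

      φ : Fin (suc (2 * k)) → Fin (p + q)
      φ i = join p q (proj₁ (tok i))

      φ-token : ∀ i j → φ i ≡ φ j → edge i ≡ edge j × (Both S T (edge i) → side i ≡ side j)
      φ-token i j eq = token-injective (at-v i) (at-v j) (proj₂ (tok i)) (proj₂ (tok j))
        (trans (sym (splitAt-join p q _)) (trans (cong (splitAt p) eq) (splitAt-join p q _)))

      edge-fresh : ∀ i → g ≢ edge (suc i)
      edge-fresh i refl = ¬ag (proj₁ (proj₂ (occupied i)))

      -- An edge in both sets occupies two slots, told apart by their copy; any other edge occupies
      -- only its assigned slot.
      same-slot : ∀ {e f x y} → e ≡ f → (Both S T e → proj₁ x ≡ proj₁ y) →
        Occupies e (d e) x → Occupies f (d f) y → x ≡ y
      same-slot refl sides (i≡ , inj₁ b)  (j≡ , _)       = cong₂ _,_ (sides b) (trans (sym i≡) j≡)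
      same-slot refl sides (i≡ , inj₂ _)  (j≡ , inj₁ b)  = cong₂ _,_ (sides b) (trans (sym i≡) j≡)
      same-slot refl sides (i≡ , inj₂ s≡) (j≡ , inj₂ t≡) =
        cong₂ _,_ (trans (sym s≡) t≡) (trans (sym i≡) j≡)

      slot-injective : ∀ {i j} → slot i ≡ slot j → i ≡ j
      slot-injective {i} {j} eq =
        trans (sym (combine-remQuot {2} k i)) (trans (cong (uncurry combine) eq) (combine-remQuot {2} k j))

      no-collision : ¬ (∃[ i ] ∃[ j ] (i < j × φ i ≡ φ j))
      no-collision (zero  , suc j , _   , eq) = edge-fresh j (proj₁ (φ-token zero (suc j) eq))
      no-collision (suc i , suc j , i<j , eq) with φ-token (suc i) (suc j) eq
      ... | same , sides = <⇒≢ i<j (cong suc (slot-injective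
        (same-slot same sides (proj₂ (proj₂ (proj₂ (occupied i)))) (proj₂ (proj₂ (proj₂ (occupied j)))))))

    ConflictFree : List Edge → (Edge → Slot) → Set
    ConflictFree es d = ∀ {e f x} → Active es e → Active es f → Adjacent e f →
                        Occupies e (d e) x → ¬ Occupies f (d f) x

    -- Copies and colours are transposed separately. Exchanging just two slots could separate the
    -- two copies of a colour, which an edge of S ∩ T must occupy together.
    swap : Slot → Slot → Slot → Slot
    swap (b , i) (c , j) = map (transpose b c) (transpose i j)

    swap-left : ∀ x y → swap x y x ≡ y
    swap-left (b , i) (c , j) = cong₂ _,_ (transpose-left b c) (transpose-left i j)

    swap-occupies : ∀ x y {e s z} → Occupies e (swap x y s) z → Occupies e s (swap y x z)
    swap-occupies (b , i) (c , j) (refl , same) =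
      sym (transpose-inverse j i) , map₂ (λ { refl → sym (transpose-inverse c b) }) same

    module Extension {es d g x₁ x₂} (free : ConflictFree es d)
      (hg : Either S T g) (¬ag : ¬ Active es g) (bridge : Bridge G (Either S T) g)
      (free₁ : ¬ OccupiedAt es d (end₁ g) x₁) (free₂ : ¬ OccupiedAt es d (end₂ g) x₂) where

      A : Vertex → Bool
      A = proj₁ bridge

      A₁ : A (end₁ g) ≡ false
      A₁ = proj₁ (proj₂ bridge)

      A₂ : A (end₂ g) ≡ true
      A₂ = proj₁ (proj₂ (proj₂ bridge))

      closed : ∀ f → Either S T f → f ≢ g → A (end₁ f) ≡ A (end₂ f)
      closed = proj₂ (proj₂ (proj₂ bridge))

      -- On the side of `end₂ g`, where `A` is true, `x₂` is renamed to `x₁`; the other side is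
      -- unchanged. Thus `x₁` becomes free at both ends of `g`.
      recolour recolour⁻¹ : Bool → Slot → Slot
      recolour   a x = if a then swap x₂ x₁ x else x
      recolour⁻¹ a x = if a then swap x₁ x₂ x else x

      recolour-occupies : ∀ a {e s z} → Occupies e (recolour a s) z → Occupies e s (recolour⁻¹ a z)
      recolour-occupies false o = o
      recolour-occupies true  o = swap-occupies x₂ x₁ o

      -- Reading the side at `end₁ f` is harmless: an edge of S ∪ T other than `g` has both ends on
      -- one side.
      extended : Edge → Slot
      extended f = if does (f ≟ g) then x₁ else recolour (A (end₁ f)) (d f)

      side-at : ∀ {f v} → Either S T f → f ≢ g → Incident v f → A (end₁ f) ≡ A v
      side-at hf f≢g (inj₁ refl) = refl
      side-at hf f≢g (inj₂ refl) = closed _ hf f≢g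

      -- The inverse renaming depends only on `v`, so a conflict at `v` between two older edges
      -- pulls back to a conflict under `d`.
      old : ∀ {f v x} → f ≢ g → Either S T f → Incident v f →
            Occupies f (extended f) x → Occupies f (d f) (recolour⁻¹ (A v) x)
      old {f} f≢g hf vf o with f ≟ g
      ... | yes f≡g = contradiction f≡g f≢g
      ... | no  _   = subst (λ a → Occupies f (d f) (recolour⁻¹ a _)) (side-at hf f≢g vf) (recolour-occupies (A (end₁ f)) o)

      new : ∀ {x} → Occupies g (extended g) x → x ≡ x₁
      new o with g ≟ g
      new (_ , inj₁ b)        | yes _ = contradiction (inj₁ b) ¬ag
      new (refl , inj₂ refl)  | yes _ = refl
      ... | no g≢g = contradiction refl g≢g

      free-at : ∀ {v} → Incident v g → ¬ OccupiedAt es d v (recolour⁻¹ (A v) x₁)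
      free-at (inj₁ refl) = subst (λ a → ¬ OccupiedAt es d _ (recolour⁻¹ a x₁)) (sym A₁) free₁
      free-at (inj₂ refl) = subst (λ a → ¬ OccupiedAt es d _ (recolour⁻¹ a x₁)) (sym A₂)
        (subst (λ x → ¬ OccupiedAt es d _ x) (sym (swap-left x₁ x₂)) free₂)

      shrink : ∀ {f} → f ≢ g → Active (g ∷ es) f → Active es f
      shrink _   (inj₁ b)                = inj₁ b
      shrink f≢g (inj₂ (_ , here f≡g))   = contradiction f≡g f≢g
      shrink _   (inj₂ (hf , there f∈))  = inj₂ (hf , f∈)

      clash : ∀ {f v x} → f ≢ g → Active (g ∷ es) f → Incident v g → Incident v f →
              Occupies g (extended g) x → ¬ Occupies f (extended f) x
      clash f≢g af vg vf og of with refl ← new og =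
        free-at vg (_ , shrink f≢g af , vf , old f≢g (active⇒either af) vf of)

      conflictFree : ConflictFree (g ∷ es) extended
      conflictFree {e} {f} ae af adj@(e≢f , v , ve , vf) oe of = cases (e ≟ g) (f ≟ g)
        where
        cases : Dec (e ≡ g) → Dec (f ≡ g) → ⊥
        cases (yes refl) (yes refl) = e≢f refl
        cases (yes refl) (no f≢g)   = clash f≢g af ve vf oe of
        cases (no e≢g)   (yes refl) = clash e≢g ae vf ve of oe
        cases (no e≢g)   (no f≢g)   = free (shrink e≢g ae) (shrink f≢g af) adj
          (old e≢g (active⇒either ae) ve oe) (old f≢g (active⇒either af) vf of)

    -- With no edge listed only S ∩ T is active, and the colouring of S serves since p ≤ k. The copy
    -- `zero` is arbitrary, as these edges take both copies.
    conflictFree-both : ConflictFree [] (λ e → zero , inject≤ (cS e) p≤k)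
    conflictFree-both (inj₁ (e∈S , _)) (inj₁ (f∈S , _)) adj (e≡ , _) (f≡ , _) =
      properS _ _ e∈S f∈S adj (inject≤-injective p≤k p≤k _ _ (trans e≡ (sym f≡)))

    module _ (bridges : ∀ g → Either S T g → ¬ Both S T g → Bridge G (Either S T) g) where

      -- Only an edge of S Δ T that is not yet active requires an extension; otherwise the active
      -- edges stay the same.
      conflictFree-exists : ∀ es → ∃[ d ] ConflictFree es d
      conflictFree-exists []       = _ , conflictFree-both
      conflictFree-exists (g ∷ es) with conflictFree-exists es
      ... | d , free with either? S T g | active? es g
      ...   | yes hg | no ¬ag = _ , Extension.conflictFree free hg ¬ag (bridges g hg (¬ag ∘ inj₁))
        (proj₂ (free-slot es d hg ¬ag (inj₁ refl))) (proj₂ (free-slot es d hg ¬ag (inj₂ refl)))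
      ...   | no ¬hg | _      = d , λ ae af → free (drop absurd ae) (drop absurd af)
        where absurd = λ hg → contradiction hg ¬hg
      ...   | yes _  | yes ag = d , λ ae af → free (drop (λ _ → ag) ae) (drop (λ _ → ag) af)

      redistribute : ∃[ X ] ∃[ Y ] (Colourable k X × Colourable k Y × ∣ X ∣ + ∣ Y ∣ ≡ ∣ S ∣ + ∣ T ∣)
      redistribute with conflictFree-exists (allFin ∣E∣)
      ... | d , free = X zero , X (suc zero) , (proj₂ ∘ d , proper _) , (proj₂ ∘ d , proper _) ,
                       ∣part∣ (proj₁ ∘ d) S T
        where
        X : Fin 2 → Subset ∣E∣
        X b = part (proj₁ ∘ d) b S T

        active : ∀ {b e} → e ∈ X b → Active (allFin ∣E∣) e × (Both S T e ⊎ proj₁ (d e) ≡ b)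
        active {e = e} e∈ with ∈-part⁻ {c = proj₁ ∘ d} S T e∈
        ... | inj₁ b         = inj₁ b , inj₁ b
        ... | inj₂ (h , eq)  = inj₂ (h , ∈-allFin e) , inj₂ eq

        proper : ∀ b → Proper (X b) (proj₂ ∘ d)
        proper b e f e∈ f∈ adj eq =
          let ae , se = active e∈ ; af , sf = active f∈ in
          -- Two edges of part `b` with equal colours would both occupy copy `b` of that colour.
          free {x = b , _} ae af adj (eq , se) (refl , sf)

-- Removing an edge of the unique cycle

module _ (G : Graph) where
  open Graph G hiding (AtMostOneCycle)

  proper-⊆ : ∀ {k S S′} {c : Edge → Fin k} → S′ ⊆ S → Proper S c → Proper S′ c
  proper-⊆ S′⊆S proper e f e∈ f∈ = proper e f (S′⊆S e∈) (S′⊆S f∈)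

  -- A cycle through `f` inside `H` would, by uniqueness, contain `g`, which lies outside `H`.
  bridges-avoiding : AtMostOneCycle G → ∀ {g} {H : Pred Edge 0ℓ} → Decidable H → ¬ H g →
    ∃[ C ] g ∈ᶜ C → ∀ f → H f → Bridge G H f
  bridges-avoiding unique {g} H? ¬Hg (C , g∈C) f Hf with bridge-or-cycle G H? f
  ... | inj₁ bridge             = bridge
  ... | inj₂ (D , _ , D⊆H) with D⊆H g (Equivalence.to (unique C D g) g∈C)
  ...   | inj₁ Hg   = contradiction Hg ¬Hg
  ...   | inj₂ refl = contradiction Hf ¬Hg

-- The inequality

module _ (G : Graph) (unique : AtMostOneCycle G) where
  open Graph G hiding (AtMostOneCycle)

  -- The `suc` pays for the one edge of S Δ T that may have to be deleted to destroy the cycle.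
  ν-concave-up-to-one : ∀ {k p q} → p ≤ k → p + q ≤ 2 * k → ∀ {S T} →
    Colourable p S → Colourable q T → ∣ S ∣ + ∣ T ∣ ≤ suc (ν k G + ν k G)
  ν-concave-up-to-one {k} {p} {q} p≤k p+q≤2k {S} {T} (cS , properS) (cT , properT) =
    conclude (all-or-any classify)
    where
    bound : ∀ {S T} → Proper S cS → Proper T cT →
            (∀ g → Either S T g → ¬ Both S T g → Bridge G (Either S T) g) →
            ∣ S ∣ + ∣ T ∣ ≤ ν k G + ν k G
    bound properS properT bridges with redistribute G p≤k p+q≤2k properS properT bridges
    ... | X , Y , colX , colY , eq =
      ≤-trans (≤-reflexive (sym eq)) (+-mono-≤ (ν-upper k G X colX) (ν-upper k G Y colY))

    Cyclic : Edge → Set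
    Cyclic g = Either S T g × ¬ Both S T g × ∃[ C ] g ∈ᶜ C

    classify : ∀ g → (Either S T g → ¬ Both S T g → Bridge G (Either S T) g) ⊎ Cyclic g
    classify g with either? S T g | both? S T g | bridge-or-cycle G (either? S T) g
    ... | no ¬h | _     | _                   = inj₁ λ h → contradiction h ¬h
    ... | yes _ | yes b | _                   = inj₁ λ _ ¬b → contradiction b ¬b
    ... | yes _ | no _  | inj₁ bridge         = inj₁ λ _ _ → bridge
    ... | yes h | no ¬b | inj₂ (C , g∈C , _)  = inj₂ (h , ¬b , C , g∈C)

    conclude : (∀ g → Either S T g → ¬ Both S T g → Bridge G (Either S T) g) ⊎ ∃[ g ] Cyclic g →
               ∣ S ∣ + ∣ T ∣ ≤ suc (ν k G + ν k G)
    conclude (inj₁ bridges) = m≤n⇒m≤1+n (bound properS properT bridges)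
    -- As `g` is not in T, deleting it from S removes it from the union, and every remaining edge
    -- becomes a bridge.
    conclude (inj₂ (g , inj₁ g∈S , ¬b , C)) = ≤-trans
      (+-monoˡ-≤ ∣ T ∣ (∣p∣≤1+∣p-x∣ S g))
      (s≤s (bound (proper-⊆ G (p─q⊆p S _) properS) properT λ f h _ →
        bridges-avoiding G unique (either? (S - g) T)
          [ x∉p-x S , (λ g∈T → ¬b (g∈S , g∈T)) ]′ C f h))
    conclude (inj₂ (g , inj₂ g∈T , ¬b , C)) = ≤-trans
      (+-monoʳ-≤ ∣ S ∣ (∣p∣≤1+∣p-x∣ T g))
      (≤-trans (≤-reflexive (+-suc _ _))
      (s≤s (bound properS (proper-⊆ G (p─q⊆p T _) properT) λ f h _ →
        bridges-avoiding G unique (either? S (T - g))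
          [ (λ g∈S → ¬b (g∈S , g∈T)) , x∉p-x T ]′ C f h)))

theorem13 : (k : ℕ) → 2 ≤ k → (G : Graph) → AtMostOneCycle G →
    ν k G ≥ (ν (k ∸ 1) G + ν (k + 1) G) / 2
-- The bound k ≥ 2 makes k - 1 positive, so that `ν m G` is attained by an actual subgraph.
theorem13 k@(suc m@(suc _)) (s≤s (s≤s z≤n)) G unique
  with ν-attained m G | ν-attained (k + 1) G
... | S , colS , S≡ | T , colT , T≡ = m≤1+n+n⇒m/2≤n (subst₂ (λ s t → s + t ≤ suc (ν k G + ν k G)) S≡ T≡
  (ν-concave-up-to-one G unique (n≤1+n m) (≤-reflexive (sum m)) colS colT))
  where
  sum : ∀ n → n + (suc n + 1) ≡ 2 * suc n
  sum = solve-∀
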